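{- For every ground ES $\mathcal{E}$ and every reduced ground TRS $\mathcal{R}$ that is equivalent to $\mathcal{E}$ (i.e. $\leftrightarrow_{\mathcal{E}}^*\,=\,\leftrightarrow_{\mathcal{R}}^*$) there exist a reduction order $>$ and a $\mathsf{KB_g}$ derivation (with respect to $>$) $(\mathcal{E},\varnothing)\vdash_{\mathsf g}\cdots\vdash_{\mathsf g}(\varnothing,\mathcal{R})$.
   Context: An ES is a set of pairs of terms $s\approx t$ and a TRS a set of rules $\ell\to r$; they are ground if all their terms are ground (variable-free). For a set $X$ of pairs of terms, $\to_X$ is its closure under contexts and substitutions, $\leftrightarrow_X^*$ the induced conversion relation, and $\mathrm{NF}(X)$ the set of $\to_X$-normal forms. A reduction order is a well-founded strict order on terms closed under contexts and substitutions. A TRS $\mathcal{R}$ is reduced if for every $\ell\to r\in\mathcal{R}$ we have $\ell\in\mathrm{NF}(\mathcal{R}\setminus\{\ell\to r\})$ and $r\in\mathrm{NF}(\mathcal{R})$. Inference system $\mathsf{KB_g}$ of ground completion (for a fixed reduction order $>$; $\uplus$ is disjoint union): $(\mathcal{E},\mathcal{R})\vdash_{\mathsf g}(\mathcal{E}',\mathcal{R}')$ if it is an instance of one of - orient: $(\mathcal{E}\uplus\{s\approx t\},\mathcal{R})\vdash(\mathcal{E},\mathcal{R}\cup\{s\to t\})$ if $s>t$, and $(\mathcal{E}\uplus\{s\approx t\},\mathcal{R})\vdash(\mathcal{E},\mathcal{R}\cup\{t\to s\})$ if $t>s$; - delete: $(\mathcal{E}\uplus\{s\approx s\},\mathcal{R})\vdash(\mathcal{E},\mathcal{R})$;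 - compose: $(\mathcal{E},\mathcal{R}\uplus\{s\to t\})\vdash(\mathcal{E},\mathcal{R}\cup\{s\to u\})$ if $t\to_{\mathcal{R}}u$; - simplify: $(\mathcal{E}\uplus\{s\approx t\},\mathcal{R})\vdash(\mathcal{E}\cup\{u\approx t\},\mathcal{R})$ if $s\to_{\mathcal{R}}u$, and $(\mathcal{E}\uplus\{s\approx t\},\mathcal{R})\vdash(\mathcal{E}\cup\{s\approx u\},\mathcal{R})$ if $t\to_{\mathcal{R}}u$; - collapse: $(\mathcal{E},\mathcal{R}\uplus\{t\to s\})\vdash(\mathcal{E}\cup\{u\approx s\},\mathcal{R})$ if $t\to_{\mathcal{R}}u$.
   Formalization: The ES is assumed finite, since for an infinite ES no finite derivation can reach the empty ES (each step removes at most one equation); equality of function symbols is assumed decidable, which excluded middle supplies. -}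

module Defs where

open import Level using (0ℓ)
open import Data.Nat.Base using (ℕ)
open import Data.Fin.Base using (Fin)
open import Data.Vec.Base using (Vec; []; _∷_; _[_]≔_)
open import Data.Vec.Relation.Unary.All using (All)
open import Data.List.Base using (List)
import Data.List.Membership.Propositional as List
open import Data.Product.Base using (_×_; _,_; ∃-syntax)
open import Function.Base using (flip)
open import Induction.WellFounded using (WellFounded)
open import Relation.Binary.Core using (Rel)
open import Relation.Binary.Construct.Closure.Equivalence using (EqClosure)
open import Relation.Binary.Construct.Closure.ReflexiveTransitive using (Star)
open import Relation.Binary.PropositionalEquality.Core using (_≡_)
open import Relation.Binary.Rewriting using (IsNormalForm)
open import Relation.Binary.Structures using (IsStrictPartialOrder)
open import Relation.Unary using (Pred; _∈_; _∉_; _≐_; _∪_; _∖_; ｛_｝)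

record Signature : Set₁ where
  field
    Symbol : Set
    arity  : Symbol → ℕ

open Signature public

data Term (F : Signature) (V : Set) : Set where
  var : V → Term F V
  fun : (f : Symbol F) → Vec (Term F V) (arity F f) → Term F V

variable
  F : Signature
  V : Set

data Ground {F : Signature} {V : Set} : Term F V → Set where
  fun : ∀ {f ts} → All Ground ts → Ground (fun f ts)

Substitution : Signature → Set → Set
Substitution F V = V → Term F V

infixl 8 _·_ _·*_

mutual
  _·_ : Term F V → Substitution F V → Term F V
  var x    · σ = σ x
  fun f ts · σ = fun f (ts ·* σ)

  _·*_ : ∀ {n} → Vec (Term F V) n → Substitution F V → Vec (Term F V) n
  []       ·* σ = []
  (t ∷ ts) ·* σ = t · σ ∷ ts ·* σ

-- In  fun f ts i C  the subcontext C sits at argument position i; the i-th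
-- entry of ts is a dummy, overwritten when the hole is filled.
data Context (F : Signature) (V : Set) : Set where
  □   : Context F V
  fun : (f : Symbol F) → Vec (Term F V) (arity F f) → Fin (arity F f) →
        Context F V → Context F V

infix 9 _⟦_⟧

_⟦_⟧ : Context F V → Term F V → Term F V
□            ⟦ t ⟧ = t
fun f ts i C ⟦ t ⟧ = fun f (ts [ i ]≔ C ⟦ t ⟧)

-- A set of pairs of terms serves both as an ES and as a TRS. Sets are
-- predicates, and equality of sets is _≐_.
Pairs : Signature → Set → Set₁
Pairs F V = Pred (Term F V × Term F V) 0ℓ

GroundPairs : Pairs F V → Set
GroundPairs X = ∀ {s t} → (s , t) ∈ X → Ground s × Ground t

Finite : Pairs F V → Set
Finite X = ∃[ ps ] X ≐ (List._∈ ps)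

Rewrite : Pairs F V → Rel (Term F V) 0ℓ
Rewrite X s t =
  ∃[ C ] ∃[ σ ] ∃[ ℓ ] ∃[ r ]
    (ℓ , r) ∈ X × s ≡ C ⟦ ℓ · σ ⟧ × t ≡ C ⟦ r · σ ⟧

Conversion : Pairs F V → Rel (Term F V) 0ℓ
Conversion X = EqClosure (Rewrite X)

NF : Pairs F V → Pred (Term F V) 0ℓ
NF X = IsNormalForm (Rewrite X)

Reduced : Pairs F V → Set
Reduced R = ∀ {ℓ r} → (ℓ , r) ∈ R → ℓ ∈ NF (R ∖ ｛ ℓ , r ｝) × r ∈ NF R

record IsReductionOrder {F : Signature} {V : Set}
                        (_>_ : Rel (Term F V) 0ℓ) : Set where
  field
    isStrictPartialOrder : IsStrictPartialOrder _≡_ _>_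
    wellFounded          : WellFounded (flip _>_)
    closedContext        : ∀ {s t} (C : Context F V) →
                           s > t → (C ⟦ s ⟧) > (C ⟦ t ⟧)
    closedSubstitution   : ∀ {s t} (σ : Substitution F V) →
                           s > t → (s · σ) > (t · σ)

infix 4 _≐_⊎｛_｝

_≐_⊎｛_｝ : Pairs F V → Pairs F V → Term F V × Term F V → Set
X ≐ Y ⊎｛ p ｝ = p ∉ Y × X ≐ (Y ∪ ｛ p ｝)

State : Signature → Set → Set₁
State F V = Pairs F V × Pairs F V

-- E and R are the components before the step, E₀ and R₀ what remains of them
-- once the selected equation or rule has been taken out.
data KBg {F : Signature} {V : Set} (_>_ : Rel (Term F V) 0ℓ) :
         Rel (State F V) (Level.suc 0ℓ) where

  orientˡ : ∀ {E E₀ R s t} → E ≐ E₀ ⊎｛ s , t ｝ → s > t →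
            KBg _>_ (E , R) (E₀ , R ∪ ｛ s , t ｝)

  orientʳ : ∀ {E E₀ R s t} → E ≐ E₀ ⊎｛ s , t ｝ → t > s →
            KBg _>_ (E , R) (E₀ , R ∪ ｛ t , s ｝)

  delete : ∀ {E E₀ R s} → E ≐ E₀ ⊎｛ s , s ｝ →
           KBg _>_ (E , R) (E₀ , R)

  compose : ∀ {E R R₀ s t u} → R ≐ R₀ ⊎｛ s , t ｝ → Rewrite R₀ t u →
            KBg _>_ (E , R) (E , R₀ ∪ ｛ s , u ｝)

  simplifyˡ : ∀ {E E₀ R s t u} → E ≐ E₀ ⊎｛ s , t ｝ → Rewrite R s u →
              KBg _>_ (E , R) (E₀ ∪ ｛ u , t ｝ , R)

  simplifyʳ : ∀ {E E₀ R s t u} → E ≐ E₀ ⊎｛ s , t ｝ → Rewrite R t u →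
              KBg _>_ (E , R) (E₀ ∪ ｛ s , u ｝ , R)

  collapse : ∀ {E R R₀ s t u} → R ≐ R₀ ⊎｛ t , s ｝ → Rewrite R₀ t u →
             KBg _>_ (E , R) (E ∪ ｛ u , s ｝ , R₀)

-- The final state is matched up to equality of sets: predicates with the same
-- elements need not be propositionally equal.
KBgDerivation : Rel (Term F V) 0ℓ → Rel (State F V) (Level.suc 0ℓ)
KBgDerivation _>_ S (E′ , R′) =
  ∃[ E″ ] ∃[ R″ ] Star (KBg _>_) S (E″ , R″) × E″ ≐ E′ × R″ ≐ R′

{-# OPTIONS --safe #-}

-- A reduced ground system has no overlaps, so innermost evaluation computes
-- normal forms. Finitely many rules of R suffice to derive the equations of E,
-- and as R has no redundant rules these make up R. On convertible ground
-- terms, comparing the length of the normalization and then an injective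
-- monotone code in ℕ yields a total reduction order for which R-normal forms
-- are minimal. Completing E with this order terminates in a reduced system X
-- equivalent to R. Both systems have the same normal forms, which for reduced
-- ground systems forces X = R.
module Submission where

open import Defs
open import Level using (0ℓ)
open import Data.Fin.Base using (Fin; zero; suc)
open import Data.List.Base as List using (List; []; _∷_; _++_; concatMap)
import Data.List.Membership.Propositional as List
open import Data.List.Membership.Propositional.Properties
  using (∈-++⁺ˡ; ∈-++⁺ʳ; ∈-++⁻; ∈-map⁺; ∈-map⁻; ∈-filter⁺; ∈-filter⁻; ∈-∃++; ∈-concat⁺′)
open import Data.List.Relation.Binary.Permutation.Propositional using (↭-sym)
open import Data.List.Relation.Binary.Permutation.Propositional.Properties
  using (∈-resp-↭; shift)
import Data.List.Relation.Unary.Any as Any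
open import Data.List.Relation.Unary.Any using (here; there)
open import Data.Nat.Base using (ℕ; zero; suc; _+_; _*_; _≤_; _<_; z≤n; s≤s)
open import Data.Nat.Properties
open import Data.Nat.Induction using (<-wellFounded)
open import Data.Product.Base using (_×_; _,_; proj₁; proj₂; ∃-syntax; Σ-syntax; map₂)
open import Data.Product.Relation.Binary.Lex.Strict
  using (×-Lex; ×-transitive; ×-wellFounded)
open import Data.Sum.Base as Sum using (_⊎_; inj₁; inj₂; [_,_]′)
open import Data.Vec.Base using (Vec; []; _∷_; _[_]≔_; lookup)
open import Data.Vec.Properties using ([]≔-lookup; lookup∘updateAt; ∷-injective)
open import Data.Vec.Relation.Unary.All using (All; []; _∷_)
open import Function.Base using (_∘_; id; flip; _on_; const)
open import Induction.WellFounded using (WellFounded; Acc; acc)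
open import Relation.Binary.Core using (Rel; _⇔_)
import Relation.Binary.Construct.Closure.Equivalence as EqClosure
open import Relation.Binary.Construct.Closure.ReflexiveTransitive using (Star; ε; _◅_; _◅◅_)
open import Relation.Binary.Construct.Closure.Symmetric using (fwd; bwd)
import Relation.Binary.Construct.On as On
open import Relation.Binary.Definitions using (DecidableEquality; tri<; tri≈; tri>)
open import Relation.Binary.PropositionalEquality
open import Relation.Binary.Structures using (IsStrictPartialOrder)
open import Relation.Nullary using (¬_; Dec; yes; no; contradiction)
open import Relation.Nullary.Decidable using (map′; _×-dec_; _⊎-dec_)
open import Relation.Unary using (Pred; _∈_; _∉_; _⊆_; _≐_; _∪_; _∖_; ｛_｝; ∅)
open import Relation.Unary.Algebra using (∪-cong)
open import Relation.Unary.Properties using (≐-refl; ≐-sym; ≐-trans)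

-- Evaluation is a function only if redexes can be decided, so finiteness of `R`, which is not
-- given, has to be derived from that of `E` before the order can be defined. The order is then
-- built from `R` itself: the cost comes first so that a normal form, having cost zero, has nothing
-- below it in its conversion class; the code only breaks ties. Totality is available just for
-- ground terms of one conversion class over the finitely many symbols of `E`. This suffices, since
-- no inference moves a pair out of its class or introduces symbols.

all-[]≔ : ∀ {A : Set} {P : Pred A 0ℓ} {a b n} (xs : Vec A n) (i : Fin n) →
          (P a → P b) → All P (xs [ i ]≔ a) → All P (xs [ i ]≔ b)
all-[]≔ (_ ∷ _)  zero    f (p ∷ ps) = f p ∷ ps
all-[]≔ (_ ∷ xs) (suc i) f (p ∷ ps) = p ∷ all-[]≔ xs i f ps

-- Ground rewriting and maps compatible with contexts.

module _ {F : Signature} {V : Set} where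

  private
    T : Set
    T = Term F V

  mutual
    ·-ground : ∀ {t : T} {σ} → Ground t → t · σ ≡ t
    ·-ground (fun gs) = cong (fun _) (·*-ground gs)

    ·*-ground : ∀ {n} {ts : Vec T n} {σ} → All Ground ts → ts ·* σ ≡ ts
    ·*-ground []       = refl
    ·*-ground (g ∷ gs) = cong₂ _∷_ (·-ground g) (·*-ground gs)

  mutual
    ·-var : (t : T) → t · var ≡ t
    ·-var (var x)    = refl
    ·-var (fun f ts) = cong (fun f) (·*-var ts)

    ·*-var : ∀ {n} (ts : Vec T n) → ts ·* var ≡ ts
    ·*-var []       = refl
    ·*-var (t ∷ ts) = cong₂ _∷_ (·-var t) (·*-var ts)

  _∘ₛ_ : Substitution F V → Substitution F V → Substitution F V
  (σ ∘ₛ τ) x = σ x · τ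

  mutual
    ·-∘ₛ : ∀ (t : T) {σ τ} → t · σ · τ ≡ t · (σ ∘ₛ τ)
    ·-∘ₛ (var x)    = refl
    ·-∘ₛ (fun f ts) = cong (fun f) (·*-∘ₛ ts)

    ·*-∘ₛ : ∀ {n} (ts : Vec T n) {σ τ} → ts ·* σ ·* τ ≡ ts ·* (σ ∘ₛ τ)
    ·*-∘ₛ []       = refl
    ·*-∘ₛ (t ∷ ts) = cong₂ _∷_ (·-∘ₛ t) (·*-∘ₛ ts)

  ·*-[]≔ : ∀ {n} (ts : Vec T n) i {t σ} → (ts [ i ]≔ t) ·* σ ≡ (ts ·* σ) [ i ]≔ (t · σ)
  ·*-[]≔ (_ ∷ _)  zero    = refl
  ·*-[]≔ (_ ∷ ts) (suc i) = cong (_ ∷_) (·*-[]≔ ts i)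

  module _ {X : Pairs F V} (ground : GroundPairs X) where

    rewrite⁺ : ∀ {ℓ r} C → (ℓ , r) ∈ X → Rewrite X (C ⟦ ℓ ⟧) (C ⟦ r ⟧)
    rewrite⁺ {ℓ} {r} C p =
      C , var , ℓ , r , p , cong (C ⟦_⟧) (sym (·-var ℓ)) , cong (C ⟦_⟧) (sym (·-var r))

    rewrite⁻ : ∀ {s t} → Rewrite X s t →
               ∃[ C ] ∃[ ℓ ] ∃[ r ] (ℓ , r) ∈ X × s ≡ C ⟦ ℓ ⟧ × t ≡ C ⟦ r ⟧
    rewrite⁻ (C , σ , ℓ , r , p , refl , refl) =
      C , ℓ , r , p , cong (C ⟦_⟧) (·-ground (proj₁ (ground p))) ,
      cong (C ⟦_⟧) (·-ground (proj₂ (ground p)))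

  Rewrite-mono : ∀ {X Y : Pairs F V} → X ⊆ Y → ∀ {s t} → Rewrite X s t → Rewrite Y s t
  Rewrite-mono X⊆Y (C , σ , ℓ , r , p , s≡ , t≡) = C , σ , ℓ , r , X⊆Y p , s≡ , t≡

  Rewrite-arg : ∀ {X : Pairs F V} {f} ts i {u} → Rewrite X (lookup ts i) u →
                Rewrite X (fun f ts) (fun f (ts [ i ]≔ u))
  Rewrite-arg {f = f} ts i (C , σ , ℓ , r , p , s≡ , refl) =
    fun f ts i C , σ , ℓ , r , p ,
    cong (fun f) (trans (sym ([]≔-lookup ts i)) (cong (ts [ i ]≔_) s≡)) , refl

  NF-antitone : ∀ {X Y : Pairs F V} → X ⊆ Y → NF Y ⊆ NF X
  NF-antitone X⊆Y nf (u , p) = nf (u , Rewrite-mono X⊆Y p)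

  NF-args : ∀ {X : Pairs F V} {f} ts → fun f ts ∈ NF X → ∀ i → lookup ts i ∈ NF X
  NF-args ts nf i (u , p) = nf (_ , Rewrite-arg ts i p)

  -- Instead of conversions we use maps that are compatible with contexts: two
  -- convertible terms are identified by every such map that identifies the
  -- two sides of all equations.
  Congruent : (T → T) → Set
  Congruent g = ∀ C {s t} → g s ≡ g t → g (C ⟦ s ⟧) ≡ g (C ⟦ t ⟧)

  Equalizes : (T → T) → Pairs F V → Set
  Equalizes g X = ∀ {s t} → (s , t) ∈ X → g s ≡ g t

  module _ {X : Pairs F V} (ground : GroundPairs X)
           {g : T → T} (g-cong : Congruent g) (g-eq : Equalizes g X) where

    equalizes-rewrite : ∀ {s t} → Rewrite X s t → g s ≡ g t
    equalizes-rewrite p with C , ℓ , r , ℓr , refl , refl ← rewrite⁻ ground p =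
      g-cong C (g-eq ℓr)

    equalizes-conversion : ∀ {s t} → Conversion X s t → g s ≡ g t
    equalizes-conversion =
      EqClosure.gfold isEquivalence g equalizes-rewrite

  -- The signature may be infinite, so symbols are numbered injectively only on a finite list `L`,
  -- later the symbols of `E`. The predicate is preserved by rewriting with rules over `L`.
  data Over (L : List (Symbol F)) : T → Set where
    fun : ∀ {f ts} → f List.∈ L → All (Over L) ts → Over L (fun f ts)

  mutual
    Over⇒Ground : ∀ {L t} → Over L t → Ground t
    Over⇒Ground (fun _ os) = fun (Over⇒Ground* os)

    Over⇒Ground* : ∀ {L n} {ts : Vec T n} → All (Over L) ts → All Ground ts
    Over⇒Ground* []       = []
    Over⇒Ground* (o ∷ os) = Over⇒Ground o ∷ Over⇒Ground* os

  mutual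
    symbols : T → List (Symbol F)
    symbols (var x)    = []
    symbols (fun f ts) = f ∷ symbols* ts

    symbols* : ∀ {n} → Vec T n → List (Symbol F)
    symbols* []       = []
    symbols* (t ∷ ts) = symbols t ++ symbols* ts

  mutual
    Ground⇒Over : ∀ {L t} → Ground t → (∀ {f} → f List.∈ symbols t → f List.∈ L) → Over L t
    Ground⇒Over (fun gs) L⊇ = fun (L⊇ (here refl)) (Ground⇒Over* gs (L⊇ ∘ there))

    Ground⇒Over* : ∀ {L n} {ts : Vec T n} → All Ground ts →
                   (∀ {f} → f List.∈ symbols* ts → f List.∈ L) → All (Over L) ts
    Ground⇒Over* []       L⊇ = []
    Ground⇒Over* {ts = t ∷ _} (g ∷ gs) L⊇ =
      Ground⇒Over g (L⊇ ∘ ∈-++⁺ˡ) ∷ Ground⇒Over* gs (L⊇ ∘ ∈-++⁺ʳ (symbols t))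

  -- The entry of `ts` at the hole is a dummy of which nothing is known, so the assumption concerns
  -- the filled context and not `C` alone.
  Over-replace : ∀ {L s t} C → (Over L s → Over L t) → Over L (C ⟦ s ⟧) → Over L (C ⟦ t ⟧)
  Over-replace □              f o           = f o
  Over-replace (fun _ ts i C) f (fun g∈ os) = fun g∈ (all-[]≔ ts i (Over-replace C f) os)

  Over-rewrite : ∀ {L} {X : Pairs F V} → (∀ {ℓ r} → (ℓ , r) ∈ X → Over L ℓ × Over L r) →
                 ∀ {s t} → Over L s → Rewrite X s t → Over L t
  Over-rewrite over o p
    with C , ℓ , r , ℓr , refl , refl ←
      rewrite⁻ (λ q → Over⇒Ground (proj₁ (over q)) , Over⇒Ground (proj₂ (over q))) p =
      Over-replace C (const (proj₂ (over ℓr))) o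

-- An injective monotone coding of ground terms.

-- Strictly monotone in both arguments and injective, because
-- (x + y)² + x lies between (x + y)² and (x + y + 1)².
pair : ℕ → ℕ → ℕ
pair x y = suc ((x + y) * (x + y) + x)

pair-monoˡ-< : ∀ {x x′} y → x < x′ → pair x y < pair x′ y
pair-monoˡ-< y x<x′ = s≤s (+-mono-≤-< (*-mono-≤ x+y≤ x+y≤) x<x′)
  where x+y≤ = +-monoˡ-≤ y (<⇒≤ x<x′)

pair-monoʳ-< : ∀ x {y y′} → y < y′ → pair x y < pair x y′
pair-monoʳ-< x y<y′ = s≤s (+-monoˡ-< x (*-mono-< x+y< x+y<))
  where x+y< = +-monoʳ-< x y<y′

-- Strictness is due to the leading `suc` of `pair`; it makes every argument have a smaller code
-- than the term.
x<pair : ∀ x y → x < pair x y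
x<pair x y = s≤s (m≤n+m x _)

n≤n*n : ∀ n → n ≤ n * n
n≤n*n zero    = z≤n
n≤n*n (suc n) = m≤m*n (suc n) (suc n)

y<pair : ∀ x y → y < pair x y
y<pair x y = s≤s (≤-trans (m≤n+m y x) (≤-trans (n≤n*n (x + y)) (m≤m+n _ x)))

pair-sum-< : ∀ x y x′ y′ → x + y < x′ + y′ → pair x y < pair x′ y′
pair-sum-< x y x′ y′ lt = s≤s (begin-strict
  n * n + x        ≤⟨ +-monoʳ-≤ (n * n) (m≤m+n x y) ⟩
  n * n + n        ≡⟨ trans (+-comm (n * n) n) (sym (*-suc n n)) ⟩
  n * suc n        <⟨ *-monoˡ-< (suc n) (n<1+n n) ⟩
  suc n * suc n    ≤⟨ *-mono-≤ lt lt ⟩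
  n′ * n′          ≤⟨ m≤m+n _ x′ ⟩
  n′ * n′ + x′     ∎)
  where
  open ≤-Reasoning
  n  = x + y
  n′ = x′ + y′

pair-injective : ∀ {x y x′ y′} → pair x y ≡ pair x′ y′ → x ≡ x′ × y ≡ y′
pair-injective {x} {y} {x′} {y′} eq with <-cmp (x + y) (x′ + y′)
... | tri< lt _ _ = contradiction eq (<⇒≢ (pair-sum-< x y x′ y′ lt))
... | tri> _ _ gt = contradiction (sym eq) (<⇒≢ (pair-sum-< x′ y′ x y gt))
... | tri≈ _ same _ = x≡x′ , +-cancelˡ-≡ x y y′ (trans same (cong (_+ y′) (sym x≡x′)))
  where
  x≡x′ : x ≡ x′
  x≡x′ = +-cancelˡ-≡ ((x + y) * (x + y)) x x′
           (trans (suc-injective eq) (cong (λ n → n * n + x′) (sym same)))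

module Code {F : Signature} {V : Set} (rank : Symbol F → ℕ) where

  mutual
    code : Term F V → ℕ
    code (var x)    = 0
    code (fun f ts) = pair (rank f) (code* ts)

    code* : ∀ {n} → Vec (Term F V) n → ℕ
    code* []       = 0
    code* (t ∷ ts) = pair (code t) (code* ts)

  code*-[]≔-< : ∀ {n} (ts : Vec _ n) i {s t} → code s < code t →
                code* (ts [ i ]≔ s) < code* (ts [ i ]≔ t)
  code*-[]≔-< (_ ∷ ts) zero    lt = pair-monoˡ-< (code* ts) lt
  code*-[]≔-< (t ∷ ts) (suc i) lt = pair-monoʳ-< (code t) (code*-[]≔-< ts i lt)

  code-arg : ∀ {f} ts i → code (lookup ts i) < code (fun f ts)
  code-arg {f} ts i = <-trans (code-lookup ts i) (y<pair (rank f) (code* ts))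
    where
    code-lookup : ∀ {n} (ts : Vec _ n) i → code (lookup ts i) < code* ts
    code-lookup (t ∷ ts) zero    = x<pair (code t) (code* ts)
    code-lookup (t ∷ ts) (suc i) = <-trans (code-lookup ts i) (y<pair (code t) (code* ts))

  code-context : ∀ C t → code t ≤ code (C ⟦ t ⟧)
  code-context □              t = ≤-refl
  code-context (fun f ts i C) t = ≤-trans (code-context C t) (<⇒≤
    (subst (λ u → code u < code (fun f (ts [ i ]≔ C ⟦ t ⟧)))
           (lookup∘updateAt i ts) (code-arg (ts [ i ]≔ C ⟦ t ⟧) i)))

  module _ {L : List (Symbol F)}
           (rank-injective : ∀ {f g} → f List.∈ L → g List.∈ L → rank f ≡ rank g → f ≡ g) where

    mutual
      code-injective : ∀ {s t} → Over L s → Over L t → code s ≡ code t → s ≡ t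
      code-injective {fun f ss} {fun g ts} (fun f∈ os) (fun g∈ os′) eq
        with pair-injective {rank f} {code* ss} eq
      ... | rank≡ , code≡ with refl ← rank-injective f∈ g∈ rank≡ =
        cong (fun f) (code*-injective os os′ code≡)

      code*-injective : ∀ {n} {ss ts : Vec _ n} → All (Over L) ss → All (Over L) ts →
                        code* ss ≡ code* ts → ss ≡ ts
      code*-injective []       []         eq = refl
      code*-injective {ss = s ∷ ss} (o ∷ os) (o′ ∷ os′) eq
        with pair-injective {code s} {code* ss} eq
      ... | eq₁ , eq₂ = cong₂ _∷_ (code-injective o o′ eq₁) (code*-injective os os′ eq₂)

-- With constant rank the code acts as a size: an argument is strictly smaller than the term, while
-- a context never makes its content smaller.
no-proper-embedding : ∀ {F : Signature} {V : Set} {f : Symbol F} (ts : Vec (Term F V) (arity F f))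
                      i C → lookup ts i ≢ C ⟦ fun f ts ⟧
no-proper-embedding {f = f} ts i C eq = <⇒≱ (code-arg ts i)
  (subst (λ u → code (fun f ts) ≤ code u) (sym eq) (code-context C (fun f ts)))
  where open Code (const 0)

-- Decidability for finite ground systems.

module GroundEquality {F : Signature} {V : Set} (_≟ₛ_ : DecidableEquality (Symbol F)) where

  open import Data.List.Membership.DecPropositional _≟ₛ_ using (_∈?_)

  mutual
    -- The ground side drives the recursion, so decidable equality of symbols is enough: a variable
    -- on the other side settles the question negatively.
    ≟-ground : ∀ {s : Term F V} → Ground s → ∀ t → Dec (s ≡ t)
    ≟-ground (fun gs) (var x) = no λ ()
    ≟-ground (fun {f} {ss} gs) (fun g ts) with f ≟ₛ g
    ... | no f≢g   = no λ { refl → f≢g refl }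
    ... | yes refl = map′ (cong (fun f)) (λ { refl → refl }) (≟-ground* gs ts)

    ≟-ground* : ∀ {n} {ss : Vec (Term F V) n} → All Ground ss → ∀ ts → Dec (ss ≡ ts)
    ≟-ground* []       []       = yes refl
    ≟-ground* (g ∷ gs) (t ∷ ts) =
      map′ (λ { (refl , refl) → refl }) ∷-injective (≟-ground g t ×-dec ≟-ground* gs ts)

  ≟-ground-pair : ∀ {s t : Term F V} → Ground s → Ground t → ∀ p → Dec ((s , t) ≡ p)
  ≟-ground-pair gs gt (u , v) =
    map′ (λ { (refl , refl) → refl }) (λ { refl → refl , refl }) (≟-ground gs u ×-dec ≟-ground gt v)

  finite-∈? : ∀ {X : Pairs F V} → Finite X → ∀ {s t} → Ground s → Ground t → Dec ((s , t) ∈ X)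
  finite-∈? (ps , X⊆ , ⊆X) gs gt = map′ ⊆X X⊆ (Any.any? (≟-ground-pair gs gt) ps)

  finite-redex? : ∀ {X : Pairs F V} → Finite X → GroundPairs X → ∀ t → Dec (∃[ r ] (t , r) ∈ X)
  finite-redex? (ps , X⊆ , ⊆X) ground t =
    map′ (map₂ ⊆X) (map₂ X⊆) (search ps (λ p → proj₁ (ground (⊆X p))))
    where
    search : ∀ ps → (∀ {ℓ r} → (ℓ , r) List.∈ ps → Ground ℓ) → Dec (∃[ r ] (t , r) List.∈ ps)
    search []             _  = no λ ()
    search ((ℓ , r) ∷ ps) gℓ with ≟-ground (gℓ (here refl)) t
    ... | yes refl = yes (r , here refl)
    ... | no ℓ≢t   = map′ (map₂ there)
      (λ { (_ , here refl) → contradiction refl ℓ≢t ; (r , there p) → r , p })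
      (search ps (gℓ ∘ there))

  rank : List (Symbol F) → Symbol F → ℕ
  rank []      f = 0
  rank (g ∷ L) f with f ≟ₛ g
  ... | yes _ = 0
  ... | no  _ = suc (rank L f)

  rank-injective : ∀ L {f g} → f List.∈ L → g List.∈ L → rank L f ≡ rank L g → f ≡ g
  rank-injective (h ∷ L) {f} {g} f∈ g∈ eq with f ≟ₛ h | g ≟ₛ h
  ... | yes refl | yes refl = refl
  ... | no f≢h   | no g≢h   = rank-injective L (Any.tail f≢h f∈) (Any.tail g≢h g∈) (suc-injective eq)

module Reducibility {F : Signature} {V : Set} {X : Pairs F V} (ground : GroundPairs X)
                    (redex? : ∀ t → Dec (∃[ r ] (t , r) ∈ X)) where

  var-NF : ∀ x → var x ∈ NF X
  var-NF x (u , p) with rewrite⁻ ground p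
  ... | □ , ℓ , r , ℓr , refl , _ with () ← proj₁ (ground ℓr)

  fun-NF : ∀ {f} ts → (∀ r → (fun f ts , r) ∉ X) → (∀ i → lookup ts i ∈ NF X) → fun f ts ∈ NF X
  fun-NF ts noRedex args (u , p) with rewrite⁻ ground p
  ... | □           , ℓ , r , ℓr , refl , _ = noRedex r ℓr
  ... | fun f us i C , ℓ , r , ℓr , refl , _ =
    args i (_ , subst (λ s → Rewrite X s (C ⟦ r ⟧)) (sym (lookup∘updateAt i us)) (rewrite⁺ ground C ℓr))

  mutual
    reducible? : ∀ t → Dec (∃[ u ] Rewrite X t u)
    reducible? (var x) = no (var-NF x)
    reducible? (fun f ts) with redex? (fun f ts) | reducible*? ts
    ... | yes (r , p) | _               = yes (r , rewrite⁺ ground □ p)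
    ... | no _        | yes (i , u , p) = yes (_ , Rewrite-arg ts i p)
    ... | no noRedex  | no args         =
      no (fun-NF ts (λ r p → noRedex (r , p)) (λ i (u , p) → args (i , u , p)))

    reducible*? : ∀ {n} (ts : Vec _ n) → Dec (∃[ i ] ∃[ u ] Rewrite X (lookup ts i) u)
    reducible*? []       = no λ ()
    reducible*? (t ∷ ts) =
      map′ (λ { (inj₁ p) → zero , p ; (inj₂ (i , p)) → suc i , p })
           (λ { (zero , p) → inj₁ p ; (suc i , p) → inj₂ (i , p) })
           (reducible? t ⊎-dec reducible*? ts)

-- Normalization in reduced ground systems.

-- Innermost normalization, together with its number of steps. Structural
-- recursion suffices since the right-hand sides of a reduced system are normal.
module Normalization {F : Signature} {V : Set} {X : Pairs F V} (ground : GroundPairs X)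
                     (redex? : ∀ t → Dec (∃[ r ] (t , r) ∈ X)) where

  contract : Term F V → Term F V
  contract t with redex? t
  ... | yes (r , _) = r
  ... | no _        = t

  contractCost : Term F V → ℕ
  contractCost t with redex? t
  ... | yes _ = 1
  ... | no _  = 0

  mutual
    nf : Term F V → Term F V
    nf (var x)    = var x
    nf (fun f ts) = contract (fun f (nf* ts))

    nf* : ∀ {n} → Vec (Term F V) n → Vec (Term F V) n
    nf* []       = []
    nf* (t ∷ ts) = nf t ∷ nf* ts

  mutual
    cost : Term F V → ℕ
    cost (var x)    = 0
    cost (fun f ts) = cost* ts + contractCost (fun f (nf* ts))

    cost* : ∀ {n} → Vec (Term F V) n → ℕ
    cost* []       = 0
    cost* (t ∷ ts) = cost t + cost* ts

  nf*-[]≔ : ∀ {n} (ts : Vec _ n) i {s t} → nf s ≡ nf t → nf* (ts [ i ]≔ s) ≡ nf* (ts [ i ]≔ t)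
  nf*-[]≔ (_ ∷ ts) zero    eq = cong (_∷ nf* ts) eq
  nf*-[]≔ (t ∷ ts) (suc i) eq = cong (nf t ∷_) (nf*-[]≔ ts i eq)

  nf-congruent : Congruent nf
  nf-congruent □              eq = eq
  nf-congruent (fun f ts i C) eq = cong (contract ∘ fun f) (nf*-[]≔ ts i (nf-congruent C eq))

  cost*-[]≔ : ∀ {n} (ts : Vec _ n) i {s t} → cost s ≡ cost t →
              cost* (ts [ i ]≔ s) ≡ cost* (ts [ i ]≔ t)
  cost*-[]≔ (_ ∷ ts) zero    eq = cong (_+ cost* ts) eq
  cost*-[]≔ (t ∷ ts) (suc i) eq = cong (cost t +_) (cost*-[]≔ ts i eq)

  cost*-[]≔-< : ∀ {n} (ts : Vec _ n) i {s t} → cost s < cost t →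
                cost* (ts [ i ]≔ s) < cost* (ts [ i ]≔ t)
  cost*-[]≔-< (_ ∷ ts) zero    lt = +-monoˡ-< (cost* ts) lt
  cost*-[]≔-< (t ∷ ts) (suc i) lt = +-monoʳ-< (cost t) (cost*-[]≔-< ts i lt)

  contract-no-redex : ∀ {t} → (∀ r → (t , r) ∉ X) → contract t ≡ t × contractCost t ≡ 0
  contract-no-redex {t} noRedex with redex? t
  ... | yes (r , p) = contradiction p (noRedex r)
  ... | no _        = refl , refl

  mutual
    -- Both facts go together because the cost at the root is that of the term with normalized
    -- arguments.
    NF⇒nf-cost : ∀ t → t ∈ NF X → nf t ≡ t × cost t ≡ 0
    NF⇒nf-cost (var x)    _      = refl , refl
    NF⇒nf-cost (fun f ts) normal
      with nf*≡ , cost*≡ ← NF⇒nf-cost* ts (NF-args ts normal)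
      rewrite nf*≡ | cost*≡ = contract-no-redex (λ r p → normal (r , rewrite⁺ ground □ p))

    NF⇒nf-cost* : ∀ {n} (ts : Vec _ n) → (∀ i → lookup ts i ∈ NF X) → nf* ts ≡ ts × cost* ts ≡ 0
    NF⇒nf-cost* []       _      = refl , refl
    NF⇒nf-cost* (t ∷ ts) normal
      with nf≡ , cost≡ ← NF⇒nf-cost t (normal zero)
         | nf*≡ , cost*≡ ← NF⇒nf-cost* ts (normal ∘ suc)
      rewrite cost≡ = cong₂ _∷_ nf≡ nf*≡ , cost*≡

  NF⇒nf≡ : ∀ {t} → t ∈ NF X → nf t ≡ t
  NF⇒nf≡ = proj₁ ∘ NF⇒nf-cost _

  NF⇒cost≡0 : ∀ {t} → t ∈ NF X → cost t ≡ 0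
  NF⇒cost≡0 = proj₂ ∘ NF⇒nf-cost _

  contractCost≡0 : ∀ t → contractCost t ≡ 0 → contract t ≡ t
  contractCost≡0 t eq with redex? t
  ... | no _ = refl

  mutual
    cost≡0⇒nf≡ : ∀ t → cost t ≡ 0 → nf t ≡ t
    cost≡0⇒nf≡ (var x)    _  = refl
    cost≡0⇒nf≡ (fun f ts) eq
      with nf*≡ ← cost*≡0⇒nf*≡ ts (m+n≡0⇒m≡0 (cost* ts) eq)
      rewrite nf*≡ = contractCost≡0 _ (m+n≡0⇒n≡0 (cost* ts) eq)

    cost*≡0⇒nf*≡ : ∀ {n} (ts : Vec _ n) → cost* ts ≡ 0 → nf* ts ≡ ts
    cost*≡0⇒nf*≡ []       _  = refl
    cost*≡0⇒nf*≡ (t ∷ ts) eq =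
      cong₂ _∷_ (cost≡0⇒nf≡ t (m+n≡0⇒m≡0 (cost t) eq)) (cost*≡0⇒nf*≡ ts (m+n≡0⇒n≡0 (cost t) eq))

  nf-normal-args : ∀ {f} ts → (∀ i → lookup ts i ∈ NF X) → nf (fun f ts) ≡ contract (fun f ts)
  nf-normal-args ts normal = cong (contract ∘ fun _) (proj₁ (NF⇒nf-cost* ts normal))

  -- The inequality excludes the default case, in which `contract` returns its argument.
  contract-sound : ∀ {t r} → contract t ≡ r → t ≢ r → (t , r) ∈ X
  contract-sound {t} eq t≢r with redex? t
  ... | yes (r , p) = subst (λ u → (t , u) ∈ X) eq p
  ... | no _        = contradiction eq t≢r

  contract-complete : ∀ {ℓ r} → (∀ {r′} → (ℓ , r′) ∈ X → r′ ≡ r) → (ℓ , r) ∈ X → contract ℓ ≡ r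
  contract-complete {ℓ} {r} unique p with redex? ℓ
  ... | yes (r′ , p′) = unique p′
  ... | no noRedex    = contradiction (r , p) noRedex

module Canonical {F : Signature} {V : Set} (_≟ₛ_ : DecidableEquality (Symbol F))
                 {X : Pairs F V} (ground : GroundPairs X) (reduced : Reduced X) where

  open GroundEquality {F} {V} _≟ₛ_

  -- A second rule with the same left-hand side would survive the removal of the first and rewrite
  -- `ℓ` at the root.
  lhs-unique : ∀ {ℓ r r′} → (ℓ , r) ∈ X → (ℓ , r′) ∈ X → r′ ≡ r
  lhs-unique {ℓ} {r} {r′} p p′ with ≟-ground (proj₂ (ground p′)) r
  ... | yes eq = eq
  ... | no r′≢r = contradiction
    (r′ , rewrite⁺ (ground ∘ proj₁) □ (p′ , λ { refl → r′≢r refl })) (proj₁ (reduced p))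

  -- This is the absence of overlaps. A step inside an argument uses either the rule itself, whose
  -- left-hand side is too large to fit, or another rule, which reducedness forbids.
  lhs-args-NF : ∀ {f ts r} → (fun f ts , r) ∈ X → ∀ i → lookup ts i ∈ NF X
  lhs-args-NF {f} {ts} {r} p i (u , step) with rewrite⁻ ground step
  ... | C , ℓ′ , r′ , p′ , ℓ≡ , u≡
    with ≟-ground-pair (proj₁ (ground p)) (proj₂ (ground p)) (ℓ′ , r′)
  ... | yes refl = no-proper-embedding ts i C ℓ≡
  ... | no ρ≢    = NF-args ts (proj₁ (reduced p)) i
    (_ , subst (λ s → Rewrite _ s (C ⟦ r′ ⟧)) (sym ℓ≡) (rewrite⁺ (ground ∘ proj₁) C (p′ , ρ≢)))

  rhs≢lhs : ∀ {ℓ r} → (ℓ , r) ∈ X → ℓ ≢ r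
  rhs≢lhs p refl = proj₂ (reduced p) (_ , rewrite⁺ ground □ p)

  module _ (redex? : ∀ t → Dec (∃[ r ] (t , r) ∈ X)) where

    open Normalization ground redex?

    -- Both sides evaluate to `r`: the arguments of `ℓ` are already normal, so evaluation contracts
    -- `ℓ` at the root by its only rule, and `r` is normal.
    nf-equalizes : Equalizes nf X
    nf-equalizes {ℓ} {r} p with fun {ts = ts} _ ← proj₁ (ground p) =
      trans (nf-normal-args ts (lhs-args-NF p))
        (trans (contract-complete (lhs-unique p) p)
               (sym (NF⇒nf≡ (proj₂ (reduced p)))))

-- Both sides of a rule of `Y` outside `X` are `X`-normal, hence fixed by `nf`. Being identified by
-- it they coincide, but a reduced system has no trivial rule.
reduced-minimal : ∀ {F : Signature} {V : Set} → DecidableEquality (Symbol F) →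
                  {X Y : Pairs F V} (ground : GroundPairs X) (redex? : ∀ t → Dec (∃[ r ] (t , r) ∈ X)) →
                  Finite X → GroundPairs Y → Reduced Y → X ⊆ Y →
                  Equalizes (Normalization.nf ground redex?) Y → Y ⊆ X
reduced-minimal {F} {V} _≟ₛ_ ground redex? finite groundY reducedY X⊆Y equalizes {ℓ , r} p
  with GroundEquality.finite-∈? {F} {V} _≟ₛ_ finite (proj₁ (groundY p)) (proj₂ (groundY p))
... | yes p∈X = p∈X
... | no  p∉X = contradiction ℓ≡r (Canonical.rhs≢lhs {F} {V} _≟ₛ_ groundY reducedY p)
  where
  open Normalization ground redex?
  ℓ≡r : ℓ ≡ r
  ℓ≡r = trans (sym (NF⇒nf≡ (NF-antitone (λ q → X⊆Y q , λ { refl → p∉X q }) (proj₁ (reducedY p)))))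
          (trans (equalizes p) (NF⇒nf≡ (NF-antitone X⊆Y (proj₂ (reducedY p)))))

-- Reduction orders, and the order built from `R`.

-- Closure under `C` would continue `t ≻ C ⟦ t ⟧` to an infinite descending chain.
no-self-embedding : ∀ {F : Signature} {V : Set} {_≻_ : Rel (Term F V) 0ℓ} → IsReductionOrder _≻_ →
                    ∀ C t → ¬ (t ≻ (C ⟦ t ⟧))
no-self-embedding {_≻_ = _≻_} isReductionOrder C t = go (wellFounded t)
  where
  open IsReductionOrder isReductionOrder
  go : ∀ {t} → Acc (flip _≻_) t → ¬ (t ≻ (C ⟦ t ⟧))
  go (acc rs) t≻ = go (rs t≻) (closedContext C t≻)

rewrite-decreasing : ∀ {F : Signature} {V : Set} {_≻_ : Rel (Term F V) 0ℓ} → IsReductionOrder _≻_ →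
                     ∀ {X : Pairs F V} → (∀ {ℓ r} → (ℓ , r) ∈ X → ℓ ≻ r) →
                     ∀ {s t} → Rewrite X s t → s ≻ t
rewrite-decreasing isReductionOrder X⊆≻ (C , σ , ℓ , r , p , refl , refl) =
  closedContext C (closedSubstitution σ (X⊆≻ p))
  where open IsReductionOrder isReductionOrder

-- Terms are compared by the length of their normalization and then by their
-- code. Within a conversion class the former is compatible with contexts since
-- convertible arguments are replaced by the same normal form. Quantifying over
-- σ enforces closure under substitutions; on ground terms it is vacuous.
module CostOrder {F : Signature} {V : Set} {X : Pairs F V} (ground : GroundPairs X)
                 (redex? : ∀ t → Dec (∃[ r ] (t , r) ∈ X)) (rank : Symbol F → ℕ) where

  open Normalization ground redex?
  open Code {F} {V} rank

  measure : Term F V → ℕ × ℕ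
  measure t = cost t , code t

  _<ₗ_ : Rel (ℕ × ℕ) 0ℓ
  _<ₗ_ = ×-Lex _≡_ _<_ _<_

  _≻_ : Rel (Term F V) 0ℓ
  s ≻ t = ∀ σ → nf (s · σ) ≡ nf (t · σ) × measure (t · σ) <ₗ measure (s · σ)

  measure-arg : ∀ {f} ts i {s t} → nf s ≡ nf t → measure t <ₗ measure s →
                measure (fun f (ts [ i ]≔ t)) <ₗ measure (fun f (ts [ i ]≔ s))
  measure-arg {f} ts i {s} {t} nf≡ = Sum.map
    (λ cost< → +-mono-<-≤ (cost*-[]≔-< ts i cost<) (≤-reflexive contractCost≡))
    (λ (cost≡ , code<) →
      cong₂ _+_ (cost*-[]≔ ts i cost≡) contractCost≡ , pair-monoʳ-< (rank f) (code*-[]≔-< ts i code<))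
    where
    contractCost≡ : contractCost (fun f (nf* (ts [ i ]≔ t))) ≡ contractCost (fun f (nf* (ts [ i ]≔ s)))
    -- Both terms reach the root with the same evaluated arguments, so the root step costs the same.
    contractCost≡ = cong (contractCost ∘ fun f) (nf*-[]≔ ts i (sym nf≡))

  ≻-closedContext : ∀ {s t} C → s ≻ t → (C ⟦ s ⟧) ≻ (C ⟦ t ⟧)
  ≻-closedContext □ s≻t = s≻t
  ≻-closedContext {s} {t} (fun f ts i C) s≻t σ
    rewrite ·*-[]≔ ts i {C ⟦ s ⟧} {σ} | ·*-[]≔ ts i {C ⟦ t ⟧} {σ}
    with nf≡ , lt ← ≻-closedContext C s≻t σ =
    cong (contract ∘ fun f) (nf*-[]≔ (ts ·* σ) i nf≡) , measure-arg (ts ·* σ) i nf≡ lt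

  ≻-irreflexive : ∀ s → ¬ (s ≻ s)
  ≻-irreflexive s s≻s = [ <-irrefl refl , <-irrefl refl ∘ proj₂ ]′ (proj₂ (s≻s var))

  isReductionOrder : IsReductionOrder _≻_
  isReductionOrder = record
    { isStrictPartialOrder = record
      { isEquivalence = isEquivalence
      ; irrefl        = λ { {s} refl → ≻-irreflexive s }
      ; trans         = λ s≻t t≻u σ → trans (proj₁ (s≻t σ)) (proj₁ (t≻u σ)) ,
          ×-transitive {_<₂_ = _<_} isEquivalence (resp₂ _<_) <-trans <-trans
            (proj₂ (t≻u σ)) (proj₂ (s≻t σ))
      ; <-resp-≈      = resp₂ _≻_
      }
    -- The instance of `s ≻ t` at `var` maps the order into the well-founded lexicographic order on
    -- measures.
    ; wellFounded        = λ t → go (On.wellFounded (measure ∘ (_· var))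
        (×-wellFounded <-wellFounded <-wellFounded) t)
    ; closedContext      = ≻-closedContext
    ; closedSubstitution = λ {s} {t} τ s≻t σ →
        subst₂ (λ s t → nf s ≡ nf t × measure t <ₗ measure s)
               (sym (·-∘ₛ s)) (sym (·-∘ₛ t)) (s≻t (τ ∘ₛ σ))
    }
    where
    go : ∀ {t} → Acc (_<ₗ_ on (measure ∘ (_· var))) t → Acc (flip _≻_) t
    go (acc rs) = acc λ s≻t → go (rs (proj₂ (s≻t var)))

  ground-≻ : ∀ {s t} → Ground s → Ground t → nf s ≡ nf t → measure t <ₗ measure s → s ≻ t
  ground-≻ gs gt nf≡ lt σ rewrite ·-ground {σ = σ} gs | ·-ground {σ = σ} gt = nf≡ , lt

  ≻-total : ∀ {L} → (∀ {f g} → f List.∈ L → g List.∈ L → rank f ≡ rank g → f ≡ g) →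
            ∀ {s t} → Over L s → Over L t → nf s ≡ nf t → s ≢ t → s ≻ t ⊎ t ≻ s
  ≻-total rank-injective {s} {t} os ot nf≡ s≢t with <-cmp (cost s) (cost t)
  ... | tri< lt _ _ = inj₂ (ground-≻ (Over⇒Ground ot) (Over⇒Ground os) (sym nf≡) (inj₁ lt))
  ... | tri> _ _ gt = inj₁ (ground-≻ (Over⇒Ground os) (Over⇒Ground ot) nf≡ (inj₁ gt))
  ... | tri≈ _ cost≡ _ with <-cmp (code s) (code t)
  ...   | tri< lt _ _ = inj₂ (ground-≻ (Over⇒Ground ot) (Over⇒Ground os) (sym nf≡) (inj₂ (cost≡ , lt)))
  ...   | tri> _ _ gt = inj₁ (ground-≻ (Over⇒Ground os) (Over⇒Ground ot) nf≡ (inj₂ (sym cost≡ , gt)))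
  ...   | tri≈ _ code≡ _ = contradiction (code-injective rank-injective os ot code≡) s≢t

  -- A normal `s` has cost zero, hence so has any `t` below it. Then `t` is its own normal form,
  -- which it shares with `s`, so the two are equal.
  normal-≻-minimal : ∀ {s t} → s ∈ NF X → ¬ (s ≻ t)
  normal-≻-minimal {s} {t} s-NF s≻t with s≻t var
  ... | nf≡ , lt rewrite ·-var s | ·-var t = ≻-irreflexive s (subst (s ≻_) (sym s≡t) s≻t)
    where
    cost-t : measure t <ₗ measure s → cost t ≡ 0
    cost-t (inj₁ cost<)       = contradiction (subst (cost t <_) (NF⇒cost≡0 s-NF) cost<) λ ()
    cost-t (inj₂ (cost≡ , _)) = trans cost≡ (NF⇒cost≡0 s-NF)
    s≡t : s ≡ t
    s≡t = trans (sym (NF⇒nf≡ s-NF)) (trans nf≡ (cost≡0⇒nf≡ t (cost-t lt)))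

-- A well-founded order on lists.

module _ {A : Set} (_<_ : Rel A 0ℓ) where

  data Shrink : Rel (List A) 0ℓ where
    drop    : ∀ {x xs} → Shrink xs (x ∷ xs)
    replace : ∀ {x y xs} → y < x → Shrink (y ∷ xs) (x ∷ xs)
    there   : ∀ {x xs ys} → Shrink ys xs → Shrink (x ∷ ys) (x ∷ xs)

  -- Nested induction on head and tail: `replace` lowers the head and `there` the tail, each keeping
  -- the other, while `drop` leaves the accessible tail.
  Shrink-wellFounded : WellFounded _<_ → WellFounded Shrink
  Shrink-wellFounded wf []       = acc λ ()
  Shrink-wellFounded wf (x ∷ xs) = go (wf x) (Shrink-wellFounded wf xs)
    where
    go : ∀ {x xs} → Acc _<_ x → Acc Shrink xs → Acc Shrink (x ∷ xs)
    go a@(acc rs) as@(acc rss) = acc λ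
      { drop        → as
      ; (replace p) → go (rs p) as
      ; (there p)   → go a (rss p)
      }

  Shrink-drop : ∀ xs {x ys} → Shrink (xs ++ ys) (xs ++ x ∷ ys)
  Shrink-drop []       = drop
  Shrink-drop (_ ∷ xs) = there (Shrink-drop xs)

  Shrink-replace : ∀ xs {x y ys} → y < x → Shrink (xs ++ y ∷ ys) (xs ++ x ∷ ys)
  Shrink-replace []       p = replace p
  Shrink-replace (_ ∷ xs) p = there (Shrink-replace xs p)

module _ {A : Set} where

  ∈-insert⁺ : ∀ xs {ys} {x y : A} → y ≡ x ⊎ y List.∈ xs ++ ys → y List.∈ xs ++ x ∷ ys
  ∈-insert⁺ xs {ys} {x} p =
    ∈-resp-↭ (↭-sym (shift x xs ys)) ([ here , there ]′ p)

  ∈-insert⁻ : ∀ xs {ys} {x y : A} → y List.∈ xs ++ x ∷ ys → y ≡ x ⊎ y List.∈ xs ++ ys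
  ∈-insert⁻ xs {ys} {x} p = Any.toSum (∈-resp-↭ (shift x xs ys) p)

  first-or-all : ∀ {a b} {P : Set a} {Q : A → Set b} xs → (∀ {x} → x List.∈ xs → P ⊎ Q x) →
                 P ⊎ (∀ {x} → x List.∈ xs → Q x)
  first-or-all []       f = inj₂ λ ()
  first-or-all (x ∷ xs) f with f (here refl) | first-or-all xs (f ∘ there)
  ... | inj₁ p | _      = inj₁ p
  ... | inj₂ _ | inj₁ p = inj₁ p
  ... | inj₂ q | inj₂ h = inj₂ λ { (here refl) → q ; (there x∈) → h x∈ }

-- The completion procedure.

data Kind : Set where
  equation rule : Kind

_≟ₖ_ : DecidableEquality Kind
equation ≟ₖ equation = yes refl
equation ≟ₖ rule     = no λ ()
rule     ≟ₖ equation = no λ ()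
rule     ≟ₖ rule     = yes refl

-- A state of completion is stored as one list of items, tagged as equations or
-- rules. Every inference drops an item or replaces it in place by a smaller
-- one, whereas the two components separately may grow.
module Items {F : Signature} {V : Set} where

  Item : Set
  Item = Kind × Term F V × Term F V

  component : Kind → List Item → Pairs F V
  component k xs p = (k , p) List.∈ xs

  component-finite : ∀ k xs → Finite (component k xs)
  component-finite k xs =
    List.map proj₂ (List.filter of-kind? xs) ,
    (λ p → ∈-map⁺ proj₂ (∈-filter⁺ of-kind? p refl)) ,
    λ p → from (∈-map⁻ proj₂ p)
    where
    of-kind? : ∀ (x : Item) → Dec (proj₁ x ≡ k)
    of-kind? x = proj₁ x ≟ₖ k
    from : ∀ {p} → ∃[ x ] x List.∈ List.filter of-kind? xs × p ≡ proj₂ x → p ∈ component k xs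
    from (x , x∈ , refl) with x∈xs , refl ← ∈-filter⁻ of-kind? {xs = xs} x∈ = x∈xs

  component-insert : ∀ xs {k p ys} →
                     component k (xs ++ (k , p) ∷ ys) ≐ component k (xs ++ ys) ∪ ｛ p ｝
  component-insert xs =
    (λ q → [ (λ { refl → inj₂ refl }) , inj₁ ]′ (∈-insert⁻ xs q)) ,
    [ ∈-insert⁺ xs ∘ inj₂ , (λ { refl → ∈-insert⁺ xs (inj₁ refl) }) ]′

  component-insert-other : ∀ xs {k k′ p ys} → k ≢ k′ →
                           component k (xs ++ (k′ , p) ∷ ys) ≐ component k (xs ++ ys)
  component-insert-other xs k≢k′ =
    (λ q → [ (λ { refl → contradiction refl k≢k′ }) , id ]′ (∈-insert⁻ xs q)) ,
    ∈-insert⁺ xs ∘ inj₂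

  Represents : State F V → List Item → Set
  Represents (E , R) xs = E ≐ component equation xs × R ≐ component rule xs

module Completion {F : Signature} {V : Set} (_≟ₛ_ : DecidableEquality (Symbol F))
                  {_≻_ : Rel (Term F V) 0ℓ} (isReductionOrder : IsReductionOrder _≻_)
                  {L : List (Symbol F)} {h : Term F V → Term F V} (h-congruent : Congruent h)
                  (total : ∀ {s t} → Over L s → Over L t → h s ≡ h t → s ≢ t → s ≻ t ⊎ t ≻ s)
                  (E : Pairs F V) where

  open IsReductionOrder isReductionOrder
  open GroundEquality {F} {V} _≟ₛ_
  open Items {F} {V}

  -- Lists determine states only up to `≐`; starting from every representing state allows
  -- derivations to be composed.
  Reaches : List Item → List Item → Set₁
  Reaches xs ys = ∀ {S} → Represents S xs → ∃[ S′ ] Star (KBg _≻_) S S′ × Represents S′ ys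

  -- The kind may change freely when a side decreases, which lets `collapse` turn a rule back into
  -- an equation. The orientation clauses cover the steps that decrease no side.
  data _⊏_ : Rel Item 0ℓ where
    orientˡ : ∀ {s t} → (rule , s , t) ⊏ (equation , s , t)
    orientʳ : ∀ {s t} → (rule , t , s) ⊏ (equation , s , t)
    left    : ∀ {k k′ s s′ t} → s ≻ s′ → (k′ , s′ , t) ⊏ (k , s , t)
    right   : ∀ {k k′ s t t′} → t ≻ t′ → (k′ , s , t′) ⊏ (k , s , t)

  -- Since orientation may swap the sides, both orders of the pair are treated
  -- simultaneously.
  ⊏-wellFounded : WellFounded _⊏_
  ⊏-wellFounded (k , s , t) = proj₁ (go (wellFounded s) (wellFounded t) k)
    where
    go : ∀ {s t} → Acc (flip _≻_) s → Acc (flip _≻_) t → ∀ k →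
         Acc _⊏_ (k , s , t) × Acc _⊏_ (k , t , s)
    go {s} {t} as@(acc rs) at@(acc rt) = λ
      { rule     → rules
      ; equation →
          acc (λ { orientˡ → proj₁ rules ; orientʳ → proj₂ rules
                 ; (left p) → proj₁ (go (rs p) at _) ; (right p) → proj₁ (go as (rt p) _) }) ,
          acc (λ { orientˡ → proj₂ rules ; orientʳ → proj₁ rules
                 ; (left p) → proj₂ (go as (rt p) _) ; (right p) → proj₂ (go (rs p) at _) })
      }
      where
      rules : Acc _⊏_ (rule , s , t) × Acc _⊏_ (rule , t , s)
      rules =
        acc (λ { (left p) → proj₁ (go (rs p) at _) ; (right p) → proj₁ (go as (rt p) _) }) ,
        acc (λ { (left p) → proj₂ (go as (rt p) _) ; (right p) → proj₂ (go (rs p) at _) })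

  record Admissible (x : Item) : Set where
    constructor admissible
    field
      overˡ      : Over L (proj₁ (proj₂ x))
      overʳ      : Over L (proj₂ (proj₂ x))
      identified : h (proj₁ (proj₂ x)) ≡ h (proj₂ (proj₂ x))
      decreasing : proj₁ x ≡ rule → proj₁ (proj₂ x) ≻ proj₂ (proj₂ x)

  open Admissible

  EqualizesItems : (Term F V → Term F V) → List Item → Set
  EqualizesItems g xs = ∀ {k s t} → (k , s , t) List.∈ xs → g s ≡ g t

  -- The two halves of equivalence with `E`: `identified` keeps the items within conversion, `h`
  -- being later the normalization by `R`, and `entails` keeps `E` derivable from the items.
  record Invariant (xs : List Item) : Set where
    field
      all-admissible : ∀ {x} → x List.∈ xs → Admissible x
      entails        : ∀ {g} → Congruent g → EqualizesItems g xs → Equalizes g E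

  open Invariant

  Saturated : List Item → Item → Set
  Saturated xs (k , s , t) =
    k ≡ rule × s ∈ NF (component rule xs ∖ ｛ s , t ｝) × t ∈ NF (component rule xs)

  Progress : List Item → Set₁
  Progress xs = ∃[ ys ] Shrink _⊏_ ys xs × Reaches xs ys × Invariant ys

  component-ground : ∀ {xs} → (∀ {x} → x List.∈ xs → Admissible x) → ∀ k → GroundPairs (component k xs)
  component-ground adm k p = Over⇒Ground (overˡ (adm p)) , Over⇒Ground (overʳ (adm p))

  equalizes-insert : ∀ pre {k s t post} {g : Term F V → Term F V} → EqualizesItems g (pre ++ post) →
                          g s ≡ g t → EqualizesItems g (pre ++ (k , s , t) ∷ post)
  equalizes-insert pre geq gst p with ∈-insert⁻ pre p
  ... | inj₁ refl = gst
  ... | inj₂ p    = geq p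

  module _ (pre post : List Item) {k : Kind} {s t : Term F V}
           (inv : Invariant (pre ++ (k , s , t) ∷ post)) where

    private
      x : Item
      x = k , s , t

      xs zs : List Item
      xs = pre ++ x ∷ post
      zs = pre ++ post

      zs-admissible : ∀ {y} → y List.∈ zs → Admissible y
      zs-admissible = all-admissible inv ∘ ∈-insert⁺ pre ∘ inj₂

    invariant-remove : (∀ {g} → Congruent g → EqualizesItems g zs → g s ≡ g t) → Invariant zs
    invariant-remove derivable = record
      { all-admissible = zs-admissible
      ; entails        = λ g-cong geq →
          entails inv g-cong (equalizes-insert pre geq (derivable g-cong geq))
      }

    invariant-replace : ∀ {k′ s′ t′} → Admissible (k′ , s′ , t′) →
                        (∀ {g} → Congruent g → EqualizesItems g zs → g s′ ≡ g t′ → g s ≡ g t) →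
                        Invariant (pre ++ (k′ , s′ , t′) ∷ post)
    invariant-replace adm derivable = record
      { all-admissible = λ p → [ (λ { refl → adm }) , zs-admissible ]′ (∈-insert⁻ pre p)
      ; entails        = λ g-cong geq →
          entails inv g-cong (equalizes-insert pre (geq ∘ unaffected)
            (derivable g-cong (geq ∘ unaffected) (geq (∈-insert⁺ pre (inj₁ refl)))))
      }
      where
      unaffected : ∀ {x y} → y List.∈ zs → y List.∈ pre ++ x ∷ post
      unaffected = ∈-insert⁺ pre ∘ inj₂

    zs-rules-ground : GroundPairs (component rule zs)
    zs-rules-ground = component-ground zs-admissible rule

    zs-rewrite-equalizes : ∀ {g u v} → Congruent g → EqualizesItems g zs →
                           Rewrite (component rule zs) u v → g u ≡ g v
    zs-rewrite-equalizes g-cong geq = equalizes-rewrite zs-rules-ground g-cong geq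

    zs-rewrite-Over : ∀ {u v} → Over L u → Rewrite (component rule zs) u v → Over L v
    zs-rewrite-Over = Over-rewrite (λ p → overˡ (zs-admissible p) , overʳ (zs-admissible p))

    zs-rewrite-≻ : ∀ {u v} → Rewrite (component rule zs) u v → u ≻ v
    zs-rewrite-≻ = rewrite-decreasing isReductionOrder (λ p → decreasing (zs-admissible p) refl)

    zs-reducible? : ∀ u → Dec (∃[ v ] Rewrite (component rule zs) u v)
    zs-reducible? = Reducibility.reducible? zs-rules-ground
      (finite-redex? (component-finite rule zs) zs-rules-ground)

    h-zs : EqualizesItems h zs
    h-zs p = identified (zs-admissible p)

    -- The disjoint unions of the calculus demand that the selected pair be absent from the rest. A
    -- repeated item is dropped by an empty derivation, as both lists represent the same state.
    duplicate-progress : x List.∈ zs → Progress xs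
    duplicate-progress x∈ =
      zs , Shrink-drop _⊏_ pre ,
      (λ (E≐ , R≐) → _ , ε , ≐-trans E≐ same , ≐-trans R≐ same) ,
      invariant-remove (λ _ geq → geq x∈)
      where
      same : ∀ {k} → component k xs ≐ component k zs
      same = (λ p → [ (λ { refl → x∈ }) , id ]′ (∈-insert⁻ pre p)) , ∈-insert⁺ pre ∘ inj₂

  module _ (pre post : List Item) {s t : Term F V} where

    private
      zs : List Item
      zs = pre ++ post

    -- Totality leaves two cases: equal sides are deleted, distinct sides are oriented at once.
    equation-progress : Invariant (pre ++ (equation , s , t) ∷ post) → (equation , s , t) List.∉ zs →
                        Progress (pre ++ (equation , s , t) ∷ post)
    equation-progress inv fresh with all-admissible inv (∈-insert⁺ pre (inj₁ refl))
    ... | admissible os ot h≡ _ with ≟-ground (Over⇒Ground os) t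
    ...   | yes refl =
      zs , Shrink-drop _⊏_ pre ,
      (λ (E≐ , R≐) → _ , delete (fresh , ≐-trans E≐ (component-insert pre)) ◅ ε ,
         ≐-refl , ≐-trans R≐ (component-insert-other pre λ ())) ,
      invariant-remove pre post inv (λ _ _ → refl)
    ...   | no s≢t with total os ot h≡ s≢t
    ...     | inj₁ s≻t =
      pre ++ (rule , s , t) ∷ post , Shrink-replace _⊏_ pre orientˡ ,
      (λ (E≐ , R≐) → _ , orientˡ (fresh , ≐-trans E≐ (component-insert pre)) s≻t ◅ ε ,
         ≐-sym (component-insert-other pre λ ()) ,
         ≐-trans (∪-cong (≐-trans R≐ (component-insert-other pre λ ())) ≐-refl)
                 (≐-sym (component-insert pre))) ,
      invariant-replace pre post inv (admissible os ot h≡ (λ _ → s≻t)) (λ _ _ → id)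
    ...     | inj₂ t≻s =
      pre ++ (rule , t , s) ∷ post , Shrink-replace _⊏_ pre orientʳ ,
      (λ (E≐ , R≐) → _ , orientʳ (fresh , ≐-trans E≐ (component-insert pre)) t≻s ◅ ε ,
         ≐-sym (component-insert-other pre λ ()) ,
         ≐-trans (∪-cong (≐-trans R≐ (component-insert-other pre λ ())) ≐-refl)
                 (≐-sym (component-insert pre))) ,
      invariant-replace pre post inv (admissible ot os (sym h≡) (λ _ → t≻s)) (λ _ _ → sym)

    -- Both sides are tested against the remaining rules `zs`, as `collapse` and `compose` require.
    rule-progress : Invariant (pre ++ (rule , s , t) ∷ post) → (rule , s , t) List.∉ zs →
                    Progress (pre ++ (rule , s , t) ∷ post) ⊎
                    Saturated (pre ++ (rule , s , t) ∷ post) (rule , s , t)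
    rule-progress inv fresh with all-admissible inv (∈-insert⁺ pre (inj₁ refl))
    ... | admissible os ot h≡ decr
      with zs-reducible? pre post inv s | zs-reducible? pre post inv t
    ...   | yes (u , s→u) | _ = inj₁
      (pre ++ (equation , u , t) ∷ post ,
       Shrink-replace _⊏_ pre (left (zs-rewrite-≻ pre post inv s→u)) ,
       (λ (E≐ , R≐) → _ , collapse (fresh , ≐-trans R≐ (component-insert pre)) s→u ◅ ε ,
          ≐-trans (∪-cong (≐-trans E≐ (component-insert-other pre λ ())) ≐-refl)
                  (≐-sym (component-insert pre)) ,
          ≐-sym (component-insert-other pre λ ())) ,
       invariant-replace pre post inv
         (admissible (zs-rewrite-Over pre post inv os s→u) ot
           (trans (sym (zs-rewrite-equalizes pre post inv h-congruent (h-zs pre post inv) s→u)) h≡) λ ())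
         (λ g-cong geq → trans (zs-rewrite-equalizes pre post inv g-cong geq s→u)))
    ...   | no _ | yes (u , t→u) = inj₁
      (pre ++ (rule , s , u) ∷ post ,
       Shrink-replace _⊏_ pre (right (zs-rewrite-≻ pre post inv t→u)) ,
       (λ (E≐ , R≐) → _ , compose (fresh , ≐-trans R≐ (component-insert pre)) t→u ◅ ε ,
          ≐-trans E≐ (≐-trans (component-insert-other pre λ ()) (≐-sym (component-insert-other pre λ ()))) ,
          ≐-sym (component-insert pre)) ,
       invariant-replace pre post inv
         (admissible os (zs-rewrite-Over pre post inv ot t→u)
           (trans h≡ (zs-rewrite-equalizes pre post inv h-congruent (h-zs pre post inv) t→u))
           (λ _ → IsStrictPartialOrder.trans isStrictPartialOrder (decr refl) (zs-rewrite-≻ pre post inv t→u)))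
         (λ g-cong geq gsu → trans gsu (sym (zs-rewrite-equalizes pre post inv g-cong geq t→u))))
    ...   | no s-NF | no t-NF = inj₂ (refl , NF-antitone others s-NF , t-NF′)
      where
      xs : List Item
      xs = pre ++ (rule , s , t) ∷ post

      others : component rule xs ∖ ｛ s , t ｝ ⊆ component rule zs
      others (p , p≢) = [ (λ { refl → contradiction refl p≢ }) , id ]′ (∈-insert⁻ pre p)

      t-NF′ : t ∈ NF (component rule xs)
      t-NF′ (u , t→u) with rewrite⁻ (component-ground (all-admissible inv) rule) t→u
      ... | C , ℓ , r , p , t≡ , _ with ∈-insert⁻ pre p
      -- The rule itself cannot rewrite its right-hand side: `t` would contain `s`, although
      -- `s ≻ t`.
      ...   | inj₁ refl = no-self-embedding isReductionOrder C s (subst (s ≻_) t≡ (decr refl))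
      ...   | inj₂ p    = t-NF (C ⟦ r ⟧ , subst (λ t → Rewrite _ t (C ⟦ r ⟧)) (sym t≡)
                                (rewrite⁺ (zs-rules-ground pre post inv) C p))

  item-progress : ∀ pre x post → Invariant (pre ++ x ∷ post) →
                  Progress (pre ++ x ∷ post) ⊎ Saturated (pre ++ x ∷ post) x
  item-progress pre (k , s , t) post inv
    with finite-∈? (component-finite k (pre ++ post))
           (Over⇒Ground (overˡ x-adm)) (Over⇒Ground (overʳ x-adm))
    where
    x-adm : Admissible (k , s , t)
    x-adm = all-admissible inv (∈-insert⁺ pre (inj₁ refl))
  item-progress pre (k , s , t)        post inv | yes x∈   = inj₁ (duplicate-progress pre post inv x∈)
  item-progress pre (equation , s , t) post inv | no fresh = inj₁ (equation-progress pre post inv fresh)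
  item-progress pre (rule , s , t)     post inv | no fresh = rule-progress pre post inv fresh

  progress : ∀ xs → Invariant xs → Progress xs ⊎ (∀ {x} → x List.∈ xs → Saturated xs x)
  progress xs inv = first-or-all xs at
    where
    at : ∀ {x} → x List.∈ xs → Progress xs ⊎ Saturated xs x
    at {x} x∈ with pre , post , refl ← ∈-∃++ x∈ = item-progress pre x post inv

  complete : ∀ {xs} → Invariant xs →
             ∃[ ys ] Reaches xs ys × Invariant ys × (∀ {x} → x List.∈ ys → Saturated ys x)
  complete {xs} = go (Shrink-wellFounded _⊏_ ⊏-wellFounded xs)
    where
    go : ∀ {xs} → Acc (Shrink _⊏_) xs → Invariant xs →
         ∃[ ys ] Reaches xs ys × Invariant ys × (∀ {x} → x List.∈ ys → Saturated ys x)
    go {xs} (acc rs) inv with progress xs inv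
    ... | inj₂ saturated = xs , (λ rep → _ , ε , rep) , inv , saturated
    ... | inj₁ (ys , smaller , reach , inv′) with go (rs smaller) inv′
    ...   | zs , reach′ , inv″ , saturated =
      zs , (λ rep → let _ , steps , rep′ = reach rep ; _ , steps′ , rep″ = reach′ rep′ in
              _ , steps ◅◅ steps′ , rep″) ,
      inv″ , saturated

-- Finiteness and uniqueness of reduced systems.

module _ {F : Signature} {V : Set} where

  rule⇒conversion : ∀ {X : Pairs F V} → GroundPairs X → ∀ {s t} → (s , t) ∈ X → Conversion X s t
  rule⇒conversion ground p = fwd (rewrite⁺ ground □ p) ◅ ε

  Supports : List (Term F V × Term F V) → Pairs F V → Set
  Supports ps X = ∀ {g} → Congruent g → Equalizes g (List._∈ ps) → Equalizes g X

  module _ {X : Pairs F V} (ground : GroundPairs X) where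

    rewrite-support : ∀ {s t} → Rewrite X s t → ∃[ p ] p ∈ X × Supports (p ∷ []) ｛ s , t ｝
    rewrite-support step with C , ℓ , r , p , refl , refl ← rewrite⁻ ground step =
      _ , p , λ { g-cong geq refl → g-cong C (geq (here refl)) }

    -- Compactness: a conversion is a finite chain, each step of which uses one rule.
    conversion-support : ∀ {s t} → Conversion X s t →
                         ∃[ ps ] (List._∈ ps) ⊆ X × Supports ps ｛ s , t ｝
    conversion-support ε = [] , (λ ()) , λ { _ _ refl → refl }
    conversion-support (step ◅ steps) with conversion-support steps
    ... | ps , ps⊆X , supp with step
    ...   | fwd s→u with p , p∈X , supp₁ ← rewrite-support s→u =
      p ∷ ps , (λ { (here refl) → p∈X ; (there q) → ps⊆X q }) ,
      λ { g-cong geq refl → trans (supp₁ g-cong (λ { (here eq) → geq (here eq) }) refl)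
                                  (supp g-cong (geq ∘ there) refl) }
    ...   | bwd u→s with p , p∈X , supp₁ ← rewrite-support u→s =
      p ∷ ps , (λ { (here refl) → p∈X ; (there q) → ps⊆X q }) ,
      λ { g-cong geq refl → trans (sym (supp₁ g-cong (λ { (here eq) → geq (here eq) }) refl))
                                  (supp g-cong (geq ∘ there) refl) }

    list-support : ∀ es → (∀ {s t} → (s , t) List.∈ es → Conversion X s t) →
                   ∃[ ps ] (List._∈ ps) ⊆ X × Supports ps (List._∈ es)
    list-support []             conv = [] , (λ ()) , λ _ _ ()
    list-support ((s , t) ∷ es) conv
      with ps , ps⊆X , supp ← conversion-support (conv (here refl))
         | qs , qs⊆X , supp′ ← list-support es (conv ∘ there) =
      ps ++ qs , (λ p → [ ps⊆X , qs⊆X ]′ (∈-++⁻ ps p)) ,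
      λ { g-cong geq (here refl) → supp g-cong (geq ∘ ∈-++⁺ˡ) refl
        ; g-cong geq (there p)   → supp′ g-cong (geq ∘ ∈-++⁺ʳ ps) p }

  -- The finitely many rules used to derive E already generate the conversion
  -- of R, so by minimality they are all of R.
  reduced-finite : DecidableEquality (Symbol F) → {E R : Pairs F V} →
                   GroundPairs E → Finite E → GroundPairs R → Reduced R →
                   Conversion E ⇔ Conversion R → Finite R
  reduced-finite _≟ₛ_ {E} {R} groundE (es , E⊆ , ⊆E) groundR reducedR (E⇒R , R⇒E)
    with ps , ps⊆R , supp ← list-support groundR es (λ p → E⇒R (rule⇒conversion groundE (⊆E p))) =
      ps ,
      reduced-minimal _≟ₛ_ ground redex? finite groundR reducedR ps⊆R
        (λ p → equalizes-conversion groundE nf-congruent (supp nf-congruent nf-eq ∘ E⊆)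
                 (R⇒E (rule⇒conversion groundR p))) ,
      ps⊆R
    where
    finite : Finite (List._∈ ps)
    finite = ps , id , id
    ground : GroundPairs (List._∈ ps)
    ground = groundR ∘ ps⊆R
    redex? : ∀ t → Dec (∃[ r ] (t , r) List.∈ ps)
    redex? = GroundEquality.finite-redex? {F} {V} _≟ₛ_ finite ground
    -- Reducedness passes to subsets, since fewer rules leave more normal forms.
    reduced : Reduced (List._∈ ps)
    reduced p =
      NF-antitone (λ (q , q≢) → ps⊆R q , q≢) (proj₁ (reducedR (ps⊆R p))) ,
      NF-antitone ps⊆R (proj₂ (reducedR (ps⊆R p)))
    open Normalization ground redex?
    nf-eq : Equalizes nf (List._∈ ps)
    nf-eq = Canonical.nf-equalizes {F} {V} _≟ₛ_ ground reduced redex?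

-- A rule ℓ → r of R has normal arguments and normal right-hand side with
-- respect to R. As R-normal forms are minimal for ≻ they are also X-normal, so
-- X can only rewrite ℓ at the root, and to r.
canonical-unique : ∀ {F : Signature} {V : Set} → DecidableEquality (Symbol F) →
  {R X : Pairs F V} (groundR : GroundPairs R) (redexR? : ∀ t → Dec (∃[ r ] (t , r) ∈ R))
  (groundX : GroundPairs X) (redexX? : ∀ t → Dec (∃[ r ] (t , r) ∈ X)) →
  Finite R → Reduced R → Reduced X → (rank : Symbol F → ℕ) →
  (∀ {ℓ r} → (ℓ , r) ∈ X → CostOrder._≻_ groundR redexR? rank ℓ r) →
  Equalizes (Normalization.nf groundR redexR?) X →
  Equalizes (Normalization.nf groundX redexX?) R →
  R ≐ X
canonical-unique {F} {V} _≟ₛ_ {R} {X} groundR redexR? groundX redexX? finiteR reducedR reducedX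
                 rank X⊆≻ nfR-X nfX-R =
  -- Once `R ⊆ X`, normalization by `R` already identifies the sides of every rule of `X`, so the
  -- reduced `X` has no room for more.
  R⊆X , reduced-minimal _≟ₛ_ groundR redexR? finiteR groundX reducedX R⊆X nfR-X
  where
  open CostOrder groundR redexR? rank
  open Normalization groundX redexX?
  module CR = Canonical {F} {V} _≟ₛ_ groundR reducedR

  NF-R⊆NF-X : NF R ⊆ NF X
  NF-R⊆NF-X t-NF (u , t→u) =
    normal-≻-minimal {t = u} t-NF (rewrite-decreasing isReductionOrder X⊆≻ t→u)

  R⊆X : R ⊆ X
  R⊆X {ℓ , r} p with fun {ts = ts} _ ← proj₁ (groundR p) =
    contract-sound
      (trans (sym (nf-normal-args ts (NF-R⊆NF-X ∘ CR.lhs-args-NF p)))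
        (trans (nfX-R p) (NF⇒nf≡ (NF-R⊆NF-X (proj₂ (reducedR p))))))
      (CR.rhs≢lhs p)

-- Completion of `E` ends in exactly `R`.

module CanonicalCompletion {F : Signature} {V : Set} (_≟ₛ_ : DecidableEquality (Symbol F))
                           {E R : Pairs F V} (groundE : GroundPairs E) (finiteE : Finite E)
                           (groundR : GroundPairs R) (reducedR : Reduced R) (finiteR : Finite R)
                           (E⇔R : Conversion E ⇔ Conversion R) where

  open GroundEquality {F} {V} _≟ₛ_

  private
    es : List (Term F V × Term F V)
    es = proj₁ finiteE

    es⊆E : (List._∈ es) ⊆ E
    es⊆E = proj₂ (proj₂ finiteE)

  L : List (Symbol F)
  L = concatMap (λ (s , t) → symbols s ++ symbols t) es

  redex? : ∀ t → Dec (∃[ r ] (t , r) ∈ R)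
  redex? = finite-redex? finiteR groundR

  open Normalization groundR redex?
  open CostOrder groundR redex? (rank L) public
  open Items {F} {V}
  open Completion _≟ₛ_ isReductionOrder nf-congruent (≻-total (rank-injective L)) E

  asEquation : Term F V × Term F V → Item
  asEquation p = equation , p

  start : List Item
  start = List.map asEquation es

  start-represents : Represents (E , ∅) start
  start-represents =
    (∈-map⁺ asEquation ∘ proj₁ (proj₂ finiteE) , λ {q} p → equation-from {q} (∈-map⁻ asEquation p)) ,
    (λ ()) , λ {q} p → no-rule {q} (∈-map⁻ asEquation p)
    where
    equation-from : ∀ {q} → ∃[ p ] p List.∈ es × (equation , q) ≡ (equation , p) → q ∈ E
    equation-from (p , p∈ , refl) = es⊆E p∈
    no-rule : ∀ {q} → ¬ (∃[ p ] p List.∈ es × (rule , q) ≡ (equation , p))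
    no-rule ()

  symbols⊆L : ∀ {s t f} → (s , t) List.∈ es → f List.∈ symbols s ++ symbols t → f List.∈ L
  symbols⊆L p f∈ = ∈-concat⁺′ f∈ (∈-map⁺ _ p)

  equation-admissible : ∀ {s t} → (s , t) List.∈ es → Admissible (equation , s , t)
  equation-admissible {s} {t} p with gs , gt ← groundE (es⊆E p) =
    admissible (Ground⇒Over gs (symbols⊆L p ∘ ∈-++⁺ˡ))
               (Ground⇒Over gt (symbols⊆L p ∘ ∈-++⁺ʳ (symbols s)))
               (equalizes-conversion groundR nf-congruent
                 (Canonical.nf-equalizes {F} {V} _≟ₛ_ groundR reducedR redex?)
                 (proj₁ E⇔R (rule⇒conversion groundE (es⊆E p))))
               λ ()

  start-invariant : Invariant start
  start-invariant = record
    { all-admissible = λ x∈ → from (∈-map⁻ asEquation x∈)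
    ; entails        = λ _ geq p → geq (∈-map⁺ asEquation (proj₁ (proj₂ finiteE) p))
    }
    where
    from : ∀ {x} → ∃[ p ] p List.∈ es × x ≡ (equation , p) → Admissible x
    from (p , p∈ , refl) = equation-admissible p∈

  saturated⇒rules≐R : ∀ {ys} → Invariant ys → (∀ {x} → x List.∈ ys → Saturated ys x) →
                      component rule ys ≐ R
  saturated⇒rules≐R {ys} inv saturated = ≐-sym (canonical-unique _≟ₛ_ groundR redex? groundX redexX?
    finiteR reducedR reducedX (rank L)
    (λ p → Admissible.decreasing (all-admissible p) refl)
    (λ p → Admissible.identified (all-admissible p))
    -- Normalization by `X` identifies the sides of all items, hence by `entails` those of `E`,
    -- hence those of the rules of `R`, which are conversions of `E`.
    λ p → equalizes-conversion groundE nfX-congruent (entails nfX-congruent nfX-items)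
            (proj₂ E⇔R (rule⇒conversion groundR p)))
    where
    open Invariant inv
    X : Pairs F V
    X = component rule ys
    groundX : GroundPairs X
    groundX = component-ground all-admissible rule
    redexX? : ∀ t → Dec (∃[ r ] (t , r) ∈ X)
    redexX? = finite-redex? (component-finite rule ys) groundX
    reducedX : Reduced X
    reducedX = proj₂ ∘ saturated
    open Normalization groundX redexX? using () renaming (nf to nfX; nf-congruent to nfX-congruent)
    nfX-items : EqualizesItems nfX ys
    -- Saturation leaves no equations, so every item is a rule of `X`.
    nfX-items p with refl ← proj₁ (saturated p) =
      Canonical.nf-equalizes {F} {V} _≟ₛ_ groundX reducedX redexX? p

  derivation : KBgDerivation _≻_ (E , ∅) (∅ , R)
  derivation = finish (complete start-invariant)
    where
    finish : ∃[ ys ] Reaches start ys × Invariant ys × (∀ {x} → x List.∈ ys → Saturated ys x) →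
             KBgDerivation _≻_ (E , ∅) (∅ , R)
    finish (ys , reach , inv , saturated) =
      let (E′ , R′) , steps , E′≐ , R′≐ = reach start-represents in
      E′ , R′ , steps ,
      ≐-trans E′≐ ((λ p → contradiction (proj₁ (saturated p)) λ ()) , λ ()) ,
      ≐-trans R′≐ (saturated⇒rules≐R inv saturated)

theorem5p12 : (F : Signature) (V : Set) → DecidableEquality (Symbol F) →
    (E R : Pairs F V) →
    GroundPairs E → Finite E →
    GroundPairs R → Reduced R →
    Conversion E ⇔ Conversion R →
    Σ[ _>_ ∈ Rel (Term F V) 0ℓ ]
    (IsReductionOrder _>_ × KBgDerivation _>_ (E , ∅) (∅ , R))
theorem5p12 F V _≟ₛ_ E R groundE finiteE groundR reducedR E⇔R =
  _≻_ , isReductionOrder , derivation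
  where
  open CanonicalCompletion {F} {V} _≟ₛ_ groundE finiteE groundR reducedR
         (reduced-finite _≟ₛ_ groundE finiteE groundR reducedR E⇔R) E⇔R
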